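{- For any infinitary formula $F$, any set $\mathcal{Q}$ of atoms that do not occur in $F$, and any definition $G$ for $\mathcal{Q}$, the map $I\mapsto I\setminus\mathcal{Q}$ is a one-to-one correspondence (bijection) between the set of stable models of $F\land G$ and the set of stable models of $F$.
   Context: Let $\sigma$ be a propositional signature (a set of atoms). Infinitary formulas over $\sigma$ of rank $r$ ($r$ a nonnegative integer) are defined recursively: every atom is a formula of rank $0$; if $\mathcal{H}$ is a set of formulas and $r$ is the smallest nonnegative integer greater than the ranks of all elements of $\mathcal{H}$, then $\mathcal{H}^\land$ and $\mathcal{H}^\lor$ are formulas of rank $r$; if $F,G$ are formulas and $r$ is the smallest nonnegative integer greater than the ranks of $F$ and $G$, then $F\rightarrow G$ is a formula of rank $r$. Abbreviations: $F\land G=\{F,G\}^\land$, $F\lor G=\{F,G\}^\lor$, $\top=\emptyset^\land$, $\bot=\emptyset^\lor$, $\neg F=F\rightarrow\bot$. An interpretation is a subset $I\subseteq\sigma$. Satisfaction: $I\models p$ iff $p\in I$; $I\models\mathcal{H}^\land$ iff $I\models F$ for all $F\in\mathcal{H}$; $I\models\mathcal{H}^\lor$ iff $I\models F$ for some $F\in\mathcal{H}$; $I\models F\rightarrow G$ iff $I\not\models F$ or $I\models G$. The reduct $F^I$: $p^I$ is $p$ if $p\in I$ and $\bot$ otherwise; $(\mathcal{H}^\land)^I=\{G^I: G\in\mathcal{H}\}^\land$; $(\mathcal{H}^\lor)^I=\{G^I: G\in\mathcal{H}\}^\lor$; $(G\rightarrow H)^I$ is $G^I\rightarrow H^I$ if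 $I\models G\rightarrow H$, and $\bot$ otherwise. An interpretation $I$ is a stable model of $F$ if it is minimal with respect to set inclusion among the interpretations satisfying $F^I$. An atom $p$ occurs in an atom $q$ iff $p=q$; it occurs in $\mathcal{H}^\land$ or $\mathcal{H}^\lor$ iff it occurs in some element of $\mathcal{H}$; it occurs in $G\rightarrow H$ iff it occurs in $G$ or in $H$. A formula $G$ is a definition for a set $\mathcal{Q}$ of atoms if it is a conjunction (of the form $\mathcal{H}^\land$) of a set of formulas each of the form $H\land C^\land\rightarrow q$, where $q$ is an atom in $\mathcal{Q}$, $C$ is a (possibly empty) subset of $\mathcal{Q}$, and $H$ is an infinitary formula in which no atoms from $\mathcal{Q}$ occur. -}

module Defs where

open import Axiom.ExcludedMiddle using (ExcludedMiddle)
open import Data.Bool.Base using (Bool; true; false; if_then_else_)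
open import Data.Empty.Polymorphic using (⊥)
open import Data.Nat.Base using (ℕ; _<_; _≤_)
open import Data.Product.Base using (Σ; ∃; _×_; _,_; proj₁)
open import Data.Sum.Base using (_⊎_)
open import Function.Base using (_∘_)
open import Level using (Level; suc; Lift; lift)
open import Relation.Binary.Bundles using (Setoid)
open import Relation.Binary.Construct.On using (isEquivalence)
open import Relation.Binary.PropositionalEquality.Core using (_≡_)
open import Relation.Nullary using (¬_; does)
open import Relation.Unary using (Pred; _∈_; _∉_; _⊆_; _≐_)
open import Relation.Unary.Relation.Binary.Equality using (≐-isEquivalence)

private
  variable
    a ℓ : Level
    σ : Set ℓ

infixr 5 _⇒_
infixr 6 _∧_
infix  4 _≈_ _⊨_

-- A set of formulas is presented as a family, so the order and multiplicity
-- of its members carry no meaning; see _≈_ for equality of formulas.  The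
-- formulas in the intended sense are the trees that have a finite rank, see
-- IsFormula.

data Tree (σ : Set ℓ) : Set (suc ℓ) where
  atom : σ → Tree σ
  ⋀ ⋁  : (A : Set ℓ) → (A → Tree σ) → Tree σ
  _⇒_  : Tree σ → Tree σ → Tree σ

pair : {X : Set a} → X → X → Lift ℓ Bool → X
pair x y (lift true)  = x
pair x y (lift false) = y

_∧_ : Tree σ → Tree σ → Tree σ
F ∧ G = ⋀ _ (pair F G)

⊥ᶠ : Tree σ
⊥ᶠ = ⋁ ⊥ λ ()

atoms : {σ : Set ℓ} → Pred σ ℓ → Tree σ
atoms C = ⋀ (∃ C) (atom ∘ proj₁)

SmallestAbove : {A : Set ℓ} → (A → ℕ) → ℕ → Set ℓ
SmallestAbove rk r = (∀ x → rk x < r) × (∀ s → (∀ x → rk x < s) → r ≤ s)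

data HasRank {σ : Set ℓ} : Tree σ → ℕ → Set (suc ℓ) where
  atom : ∀ {p} → HasRank (atom p) 0
  ⋀    : ∀ {A H r} {rk : A → ℕ} → (∀ x → HasRank (H x) (rk x)) →
         SmallestAbove rk r → HasRank (⋀ A H) r
  ⋁    : ∀ {A H r} {rk : A → ℕ} → (∀ x → HasRank (H x) (rk x)) →
         SmallestAbove rk r → HasRank (⋁ A H) r
  _⇒_  : ∀ {F G m n r} → HasRank F m → HasRank G n →
         SmallestAbove {ℓ = ℓ} (pair m n) r → HasRank (F ⇒ G) r

IsFormula : {σ : Set ℓ} → Tree σ → Set (suc ℓ)
IsFormula F = ∃ (HasRank F)

-- Equality of formulas, with families compared extensionally, i.e. as the
-- sets of their members.

_≈_ : {σ : Set ℓ} → Tree σ → Tree σ → Set ℓ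
atom p    ≈ atom q    = p ≡ q
⋀ A H     ≈ ⋀ B K     = (∀ x → ∃ λ y → H x ≈ K y) × (∀ y → ∃ λ x → H x ≈ K y)
⋁ A H     ≈ ⋁ B K     = (∀ x → ∃ λ y → H x ≈ K y) × (∀ y → ∃ λ x → H x ≈ K y)
(F₁ ⇒ G₁) ≈ (F₂ ⇒ G₂) = (F₁ ≈ F₂) × (G₁ ≈ G₂)
_         ≈ _         = ⊥

Interpretation : Set ℓ → Set (suc ℓ)
Interpretation {ℓ} σ = Pred σ ℓ

_⊨_ : {σ : Set ℓ} → Interpretation σ → Tree σ → Set ℓ
I ⊨ atom p  = p ∈ I
I ⊨ ⋀ A H   = ∀ x → I ⊨ H x
I ⊨ ⋁ A H   = ∃ λ x → I ⊨ H x
I ⊨ (F ⇒ G) = ¬ (I ⊨ F) ⊎ (I ⊨ G)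

-- The reduct is defined by cases on membership and satisfaction, which are
-- not decidable in general; excluded middle supplies the case distinction.

reduct : {σ : Set ℓ} → ExcludedMiddle ℓ → Interpretation σ → Tree σ → Tree σ
reduct em I (atom p) = if does (em {p ∈ I}) then atom p else ⊥ᶠ
reduct em I (⋀ A H)  = ⋀ A λ x → reduct em I (H x)
reduct em I (⋁ A H)  = ⋁ A λ x → reduct em I (H x)
reduct em I (F ⇒ G)  =
  if does (em {I ⊨ (F ⇒ G)}) then reduct em I F ⇒ reduct em I G else ⊥ᶠ

IsStableModel : {σ : Set ℓ} → ExcludedMiddle ℓ → Tree σ → Pred (Interpretation σ) (suc ℓ)
IsStableModel em F I =
  (I ⊨ reduct em I F) × (∀ J → J ⊨ reduct em I F → J ⊆ I → I ⊆ J)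

-- Interpretations are compared as sets (_≐_ is mutual inclusion).

StableModels : {σ : Set ℓ} → ExcludedMiddle ℓ → Tree σ → Setoid (suc ℓ) ℓ
StableModels em F = record
  { Carrier       = ∃ (IsStableModel em F)
  ; _≈_           = λ I J → proj₁ I ≐ proj₁ J
  ; isEquivalence = isEquivalence proj₁ ≐-isEquivalence
  }

Occurs : {σ : Set ℓ} → σ → Tree σ → Set ℓ
Occurs p (atom q) = p ≡ q
Occurs p (⋀ A H)  = ∃ λ x → Occurs p (H x)
Occurs p (⋁ A H)  = ∃ λ x → Occurs p (H x)
Occurs p (F ⇒ G)  = Occurs p F ⊎ Occurs p G

NoneOccurIn : {σ : Set ℓ} → Pred σ ℓ → Tree σ → Set ℓ
NoneOccurIn Q F = ∀ p → p ∈ Q → ¬ Occurs p F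

record IsRule {σ : Set ℓ} (Q : Pred σ ℓ) (R : Tree σ) : Set (suc ℓ) where
  field
    H         : Tree σ
    C         : Pred σ ℓ
    q         : σ
    form      : R ≈ (H ∧ atoms C ⇒ atom q)
    q∈Q       : q ∈ Q
    C⊆Q       : C ⊆ Q
    H-formula : IsFormula H
    H-free    : NoneOccurIn Q H

data IsDefinition {σ : Set ℓ} (Q : Pred σ ℓ) : Tree σ → Set (suc ℓ) where
  ⋀ : ∀ {A R} → (∀ x → IsRule Q (R x)) → IsDefinition Q (⋀ A R)

{-# OPTIONS --safe #-}

-- Satisfaction of a reduct, J ⊨ F^I, is here-and-there satisfaction of F by
-- the pair (J , I), and this depends only on the atoms that occur in F.
-- For a set J of atoms disjoint from Q, let Derived J be the least set closed
-- under the rules of the definition G whose H-part holds in J.  Then every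
-- stable model I of F ∧ G equals (I ∖ Q) ∪ Derived (I ∖ Q), and conversely
-- J ∪ Derived J is a stable model of F ∧ G whenever J is one of F.

module Submission where

open import Defs
open import Axiom.ExcludedMiddle using (ExcludedMiddle)
open import Data.Bool.Base using (true; false)
open import Data.Product using (Σ-syntax; ∃; _×_; _,_; proj₁; proj₂)
open import Data.Sum.Base using (inj₁; inj₂; [_,_]′)
open import Function.Base using (id; _∘_)
open import Function.Bundles using (Bijection; _⇔_; mk⇔; module Equivalence)
open import Level using (lift)
open import Relation.Binary.PropositionalEquality.Core using (refl)
open import Relation.Nullary using (yes; no; contradiction)
open import Relation.Unary
  using (Pred; _∈_; _⊆_; _≐_; _∖_; _∪_; _∩_; ∁)
open import Relation.Unary.Properties using (≐-refl; ≐-sym; ≐-trans)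

open Equivalence using (to; from)

-- Here-and-there satisfaction and equilibrium models.

infix 4 ⟨_∣_⟩⊩_

-- Asking for `p ∈ I` in the clause for atoms mirrors the reduct, which sends atoms outside `I` to
-- `⊥ᶠ`; the match holds for every `J`, not only for `J ⊆ I`.
⟨_∣_⟩⊩_ : ∀ {ℓ} {σ : Set ℓ} → Interpretation σ → Interpretation σ → Tree σ → Set ℓ
⟨ J ∣ I ⟩⊩ atom p  = p ∈ I × p ∈ J
⟨ J ∣ I ⟩⊩ ⋀ A H   = ∀ x → ⟨ J ∣ I ⟩⊩ H x
⟨ J ∣ I ⟩⊩ ⋁ A H   = ∃ λ x → ⟨ J ∣ I ⟩⊩ H x
⟨ J ∣ I ⟩⊩ (F ⇒ G) = (⟨ I ∣ I ⟩⊩ F → ⟨ I ∣ I ⟩⊩ G) × (⟨ J ∣ I ⟩⊩ F → ⟨ J ∣ I ⟩⊩ G)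

-- The equilibrium models of Pearce's equilibrium logic.
IsEquilibrium : ∀ {ℓ} {σ : Set ℓ} → Tree σ → Interpretation σ → Set _
IsEquilibrium F I = (⟨ I ∣ I ⟩⊩ F) × (∀ J → ⟨ J ∣ I ⟩⊩ F → J ⊆ I → I ⊆ J)

module _ {ℓ} {σ : Set ℓ} where

  private
    variable
      I I′ J J′ K : Interpretation σ

  ⊩-persistent : ∀ F → ⟨ J ∣ I ⟩⊩ F → ⟨ I ∣ I ⟩⊩ F
  ⊩-persistent (atom p) (p∈I , _) = p∈I , p∈I
  ⊩-persistent (⋀ A H)  h         = λ x → ⊩-persistent (H x) (h x)
  ⊩-persistent (⋁ A H)  (x , h)   = x , ⊩-persistent (H x) h
  ⊩-persistent (F ⇒ G)  (h , _)   = h , h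

  -- `IsRule` fixes the shape of a rule only up to `≈`. Both directions are proved together because
  -- antecedents swap them.
  ⊩-cong : ∀ F G → F ≈ G → (⟨ J ∣ I ⟩⊩ F) ⇔ (⟨ J ∣ I ⟩⊩ G)
  ⊩-cong (atom p) (atom q) refl = mk⇔ id id
  ⊩-cong (⋀ A H) (⋀ B K) (f , g) = mk⇔
    (λ h y → let x , e = g y in to   (⊩-cong (H x) (K y) e) (h x))
    (λ h x → let y , e = f x in from (⊩-cong (H x) (K y) e) (h y))
  ⊩-cong (⋁ A H) (⋁ B K) (f , g) = mk⇔
    (λ (x , h) → let y , e = f x in y , to   (⊩-cong (H x) (K y) e) h)
    (λ (y , h) → let x , e = g y in x , from (⊩-cong (H x) (K y) e) h)
  ⊩-cong (F₁ ⇒ G₁) (F₂ ⇒ G₂) (e , e′) = mk⇔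
    (λ (h , k) → to   (⊩-cong G₁ G₂ e′) ∘ h ∘ from (⊩-cong F₁ F₂ e) ,
                 to   (⊩-cong G₁ G₂ e′) ∘ k ∘ from (⊩-cong F₁ F₂ e))
    (λ (h , k) → from (⊩-cong G₁ G₂ e′) ∘ h ∘ to   (⊩-cong F₁ F₂ e) ,
                 from (⊩-cong G₁ G₂ e′) ∘ k ∘ to   (⊩-cong F₁ F₂ e))
  ⊩-cong (atom _) (⋀ _ _)  (lift ())
  ⊩-cong (atom _) (⋁ _ _)  (lift ())
  ⊩-cong (atom _) (_ ⇒ _)  (lift ())
  ⊩-cong (⋀ _ _)  (atom _) (lift ())
  ⊩-cong (⋀ _ _)  (⋁ _ _)  (lift ())
  ⊩-cong (⋀ _ _)  (_ ⇒ _)  (lift ())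
  ⊩-cong (⋁ _ _)  (atom _) (lift ())
  ⊩-cong (⋁ _ _)  (⋀ _ _)  (lift ())
  ⊩-cong (⋁ _ _)  (_ ⇒ _)  (lift ())
  ⊩-cong (_ ⇒ _)  (atom _) (lift ())
  ⊩-cong (_ ⇒ _)  (⋀ _ _)  (lift ())
  ⊩-cong (_ ⇒ _)  (⋁ _ _)  (lift ())

  -- Formulas free of `Q`, and rules.

  module _ {Q : Pred σ ℓ} where

    -- Atoms of `F` lie outside `Q`, where the two pairs agree. Antecedents reverse the direction,
    -- hence equalities rather than inclusions.
    ⊩-resp-∖ : ∀ F → NoneOccurIn Q F → I ∖ Q ≐ I′ ∖ Q → J ∖ Q ≐ J′ ∖ Q →
               ⟨ J ∣ I ⟩⊩ F → ⟨ J′ ∣ I′ ⟩⊩ F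
    ⊩-resp-∖ (atom p) free (i , _) (j , _) (p∈I , p∈J) =
      proj₁ (i (p∈I , p∉Q)) , proj₁ (j (p∈J , p∉Q))
      where p∉Q = λ p∈Q → free p p∈Q refl
    ⊩-resp-∖ (⋀ A H) free i j h x =
      ⊩-resp-∖ (H x) (λ p p∈Q o → free p p∈Q (x , o)) i j (h x)
    ⊩-resp-∖ (⋁ A H) free i j (x , h) =
      x , ⊩-resp-∖ (H x) (λ p p∈Q o → free p p∈Q (x , o)) i j h
    ⊩-resp-∖ (F ⇒ G) free i j (h , k) =
      ⊩-resp-∖ G freeG i i ∘ h ∘ ⊩-resp-∖ F freeF (≐-sym i) (≐-sym i) ,
      ⊩-resp-∖ G freeG i j ∘ k ∘ ⊩-resp-∖ F freeF (≐-sym i) (≐-sym j)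
      where
      freeF = λ p p∈Q o → free p p∈Q (inj₁ o)
      freeG = λ p p∈Q o → free p p∈Q (inj₂ o)

    ∖-idem : (I ∖ Q) ∖ Q ≐ I ∖ Q
    ∖-idem = (λ (p∈I∖Q , _) → p∈I∖Q) , λ (p∈I , p∉Q) → (p∈I , p∉Q) , p∉Q

    ∪-∖ : J ⊆ Q → (I ∪ J) ∖ Q ≐ I ∖ Q
    ∪-∖ J⊆Q =
      (λ { (inj₁ p∈I , p∉Q) → p∈I , p∉Q
         ; (inj₂ p∈J , p∉Q) → contradiction (J⊆Q p∈J) p∉Q }) ,
      λ (p∈I , p∉Q) → inj₁ p∈I , p∉Q

    disjoint-∖ : J ⊆ ∁ Q → J ∖ Q ≐ J
    disjoint-∖ J⊆∁Q = proj₁ , λ p∈J → p∈J , J⊆∁Q p∈J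

    -- Removing `Q` from the first set of the pair does not affect `F`, so minimality gives
    -- `I ⊆ I ∖ Q`.
    equilibrium-disjoint : ∀ F → NoneOccurIn Q F → IsEquilibrium F I → I ⊆ ∁ Q
    equilibrium-disjoint {I = I} F free (sat , min) p∈I =
      proj₂ (min (I ∖ Q) (⊩-resp-∖ F free ≐-refl (≐-sym ∖-idem) sat) proj₁ p∈I)

    module _ {R : Tree σ} (rule : IsRule Q R) where
      open IsRule rule

      -- One premise for each world. The `q ∈ I` also demanded at `J` comes from the first premise,
      -- as the body persists to `I`.
      ⊩-rule⁺ : (⟨ I ∣ I ⟩⊩ H → C ⊆ I → q ∈ I) → (⟨ J ∣ I ⟩⊩ H → C ⊆ J → q ∈ J) →
                ⟨ J ∣ I ⟩⊩ R
      ⊩-rule⁺ f g = from (⊩-cong R _ form)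
        ( (λ b → let q∈I = there b in q∈I , q∈I)
        , (λ b → there (⊩-persistent (H ∧ atoms C) b)
               , g (b (lift true)) (λ c → proj₂ (b (lift false) (_ , c)))))
        where there = λ b → f (b (lift true)) (λ c → proj₁ (b (lift false) (_ , c)))

      ⊩-rule⁻ : ⟨ J ∣ I ⟩⊩ R → ⟨ J ∣ I ⟩⊩ H → C ⊆ I ∩ J → q ∈ I ∩ J
      ⊩-rule⁻ r h c = proj₂ (to (⊩-cong R _ form) r)
        λ { (lift true) → h ; (lift false) (_ , p∈C) → c p∈C }

    -- The derived atoms.

    module _ {A : Set ℓ} {R : A → Tree σ} (rules : ∀ x → IsRule Q (R x)) where

      open module Rule x = IsRule (rules x)

      -- `H x` is evaluated in the fixed `J`, so the recursion is positive whatever implications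
      -- `H x` contains: this is the least model of a positive program.
      data Derived (J : Interpretation σ) : Interpretation σ where
        derive : ∀ x → ⟨ J ∣ J ⟩⊩ H x → C x ⊆ Derived J → Derived J (q x)

      derived⊆Q : Derived J ⊆ Q
      derived⊆Q (derive x _ _) = q∈Q x

      -- Induction on derivations: `H x` is free of `Q`, so it carries over from `(J , J)` to
      -- `(K , I)`. Both memberships are tracked because firing a rule there takes `C x` inside both
      -- sets.
      derived-least : I ∖ Q ≐ J ∖ Q → K ∖ Q ≐ J ∖ Q → ⟨ K ∣ I ⟩⊩ ⋀ A R →
                      Derived J ⊆ I ∩ K
      derived-least i k sat (derive x h c) =
        ⊩-rule⁻ (rules x) (sat x)
          (⊩-resp-∖ (H x) (H-free x) (≐-sym i) (≐-sym k) h)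
          (λ p∈C → derived-least i k sat (c p∈C))

      -- `H x` persists to `I`, which agrees with `J` outside `Q`; the atoms of `C x` lie in `Q`,
      -- hence outside `J`, so they are derived.
      derived-closed : J ⊆ ∁ Q → I ∖ Q ≐ J ∖ Q → ∀ x → ⟨ K ∣ I ⟩⊩ H x →
                       C x ⊆ J ∪ Derived J → q x ∈ J ∪ Derived J
      derived-closed J⊆∁Q i x h c =
        inj₂ (derive x (⊩-resp-∖ (H x) (H-free x) i i (⊩-persistent (H x) h))
          λ p∈C → [ (λ p∈J → contradiction (C⊆Q x p∈C) (J⊆∁Q p∈J)) , id ]′ (c p∈C))

      -- Equilibrium models of `F` and of `FG`.

      module _ (F : Tree σ) (free : NoneOccurIn Q F) where

        private
          FG = F ∧ ⋀ A R

        -- A competitor `J` for `F` below `I ∖ Q` becomes the competitor `J ∪ (I ∩ Q)` for `FG`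
        -- below `I`: it keeps all of `I ∩ Q`, so the head of any rule firing in `I` is present.
        equilibrium-∖ : IsEquilibrium FG I → IsEquilibrium F (I ∖ Q)
        equilibrium-∖ {I = I} (sat , min) =
          ⊩-resp-∖ F free (≐-sym ∖-idem) (≐-sym ∖-idem) (sat (lift true)) , minimal
          where
          minimal : ∀ J → ⟨ J ∣ I ∖ Q ⟩⊩ F → J ⊆ I ∖ Q → I ∖ Q ⊆ J
          minimal J satJ J⊆ (p∈I , p∉Q) with min (J ∪ (I ∩ Q)) satK K⊆I p∈I
            where
            K⊆I : J ∪ (I ∩ Q) ⊆ I
            K⊆I = [ proj₁ ∘ J⊆ , proj₁ ]′

            satR : ∀ x → ⟨ J ∪ (I ∩ Q) ∣ I ⟩⊩ R x
            satR x = ⊩-rule⁺ (rules x) fire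
              λ h c → inj₂ (fire (⊩-persistent (H x) h) (λ p∈C → K⊆I (c p∈C)) , q∈Q x)
              where
              fire : ⟨ I ∣ I ⟩⊩ H x → C x ⊆ I → q x ∈ I
              fire h c = proj₁ (⊩-rule⁻ (rules x) (sat (lift false) x) h
                                  (λ p∈C → c p∈C , c p∈C))

            satK : ⟨ J ∪ (I ∩ Q) ∣ I ⟩⊩ FG
            satK (lift true)  = ⊩-resp-∖ F free ∖-idem (≐-sym (∪-∖ proj₂)) satJ
            satK (lift false) = satR
          ... | inj₁ p∈J         = p∈J
          ... | inj₂ (_ , p∈Q)   = contradiction p∈Q p∉Q

        -- The right-hand side lies inside `I` by leastness of `Derived`, and paired with `I` it
        -- satisfies `FG`, so minimality of `I` applies.
        equilibrium-⊆ : IsEquilibrium FG I → I ⊆ (I ∖ Q) ∪ Derived (I ∖ Q)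
        equilibrium-⊆ {I = I} (sat , min) = min M satM [ proj₁ , proj₁ ∘ D⊆I ]′
          where
          M = (I ∖ Q) ∪ Derived (I ∖ Q)

          D⊆I : Derived (I ∖ Q) ⊆ I ∩ I
          D⊆I = derived-least (≐-sym ∖-idem) (≐-sym ∖-idem) (sat (lift false))

          satM : ⟨ M ∣ I ⟩⊩ FG
          satM (lift true)    =
            ⊩-resp-∖ F free ≐-refl (≐-sym (≐-trans (∪-∖ derived⊆Q) ∖-idem)) (sat (lift true))
          satM (lift false) x = ⊩-rule⁺ (rules x)
            (λ h c → proj₁ (⊩-rule⁻ (rules x) (sat (lift false) x) h
                              (λ p∈C → c p∈C , c p∈C)))
            (derived-closed proj₂ (≐-sym ∖-idem) x)

        -- The atoms of `I` in `Q` are derived from `I ∖ Q`; `J` agrees with `I` outside `Q` and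
        -- satisfies the rules, so leastness puts them in `J`.
        equilibrium-determined : IsEquilibrium FG I → IsEquilibrium FG J →
                                 I ∖ Q ≐ J ∖ Q → I ⊆ J
        equilibrium-determined eqI (satJ , _) e p∈I with equilibrium-⊆ eqI p∈I
        ... | inj₁ p∈I∖Q = proj₁ (proj₁ e p∈I∖Q)
        ... | inj₂ d     = proj₁ (derived-least j j (satJ (lift false)) d)
          where j = ≐-trans (≐-sym e) (≐-sym ∖-idem)

        equilibrium-∪ : IsEquilibrium F J → IsEquilibrium FG (J ∪ Derived J)
        equilibrium-∪ {J = J} eq@(sat , min) = satM , minimal
          where
          M = J ∪ Derived J

          J⊆∁Q : J ⊆ ∁ Q
          J⊆∁Q = equilibrium-disjoint F free eq

          i : M ∖ Q ≐ J ∖ Q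
          i = ∪-∖ derived⊆Q

          satM : ⟨ M ∣ M ⟩⊩ FG
          satM (lift true)    = ⊩-resp-∖ F free (≐-sym i) (≐-sym i) sat
          satM (lift false) x = ⊩-rule⁺ (rules x)
            (derived-closed J⊆∁Q i x) (derived-closed J⊆∁Q i x)

          minimal : ∀ K → ⟨ K ∣ M ⟩⊩ FG → K ⊆ M → M ⊆ K
          -- The part outside `Q` is settled first: minimality of `J` for `F` yields `J⊆K`, hence
          -- `k`, and only then does leastness place `Derived J` inside `K`.
          minimal K satK K⊆M = [ J⊆K , proj₂ ∘ derived-least i k (satK (lift false)) ]′
            where
            K∖Q⊆J : K ∖ Q ⊆ J
            K∖Q⊆J (p∈K , p∉Q) = proj₁ (proj₁ i (K⊆M p∈K , p∉Q))

            J⊆K : J ⊆ K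
            J⊆K p∈J = proj₁ (min (K ∖ Q)
              (⊩-resp-∖ F free i (≐-sym ∖-idem) (satK (lift true))) K∖Q⊆J p∈J)

            k : K ∖ Q ≐ J ∖ Q
            k = (λ p∈ → K∖Q⊆J p∈ , proj₂ p∈) , λ (p∈J , p∉Q) → J⊆K p∈J , p∉Q

  -- Reducts and stable models.

  module _ (em : ExcludedMiddle ℓ) where

    -- Since `⊨` reads an implication as a disjunction, deciding `I ⊨ F` recovers it from a
    -- function.
    ⊨⇔⊩ : ∀ F → (I ⊨ F) ⇔ (⟨ I ∣ I ⟩⊩ F)
    ⊨⇔⊩ (atom p) = mk⇔ (λ p∈I → p∈I , p∈I) proj₁
    ⊨⇔⊩ (⋀ A H)  = mk⇔ (λ h x → to (⊨⇔⊩ (H x)) (h x)) (λ h x → from (⊨⇔⊩ (H x)) (h x))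
    ⊨⇔⊩ (⋁ A H)  = mk⇔ (λ (x , h) → x , to (⊨⇔⊩ (H x)) h) (λ (x , h) → x , from (⊨⇔⊩ (H x)) h)
    ⊨⇔⊩ {I = I} (F ⇒ G) = mk⇔ (λ s → imp s , imp s) (λ (h , _) → back h)
      where
      imp : I ⊨ (F ⇒ G) → ⟨ I ∣ I ⟩⊩ F → ⟨ I ∣ I ⟩⊩ G
      imp (inj₁ ¬f) f = contradiction (from (⊨⇔⊩ F) f) ¬f
      imp (inj₂ g)  _ = to (⊨⇔⊩ G) g

      back : (⟨ I ∣ I ⟩⊩ F → ⟨ I ∣ I ⟩⊩ G) → I ⊨ (F ⇒ G)
      back h with em {I ⊨ F}
      ... | yes f = inj₂ (from (⊨⇔⊩ G) (h (to (⊨⇔⊩ F) f)))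
      ... | no ¬f = inj₁ ¬f

    -- The tests made by the reduct, `p ∈ I` and `I ⊨ (F ⇒ G)`, are the first components of the
    -- clauses for atoms and implications.
    reduct⇔⊩ : ∀ F → (J ⊨ reduct em I F) ⇔ (⟨ J ∣ I ⟩⊩ F)
    reduct⇔⊩ {I = I} (atom p) with em {p ∈ I}
    ... | yes p∈I = mk⇔ (p∈I ,_) proj₂
    ... | no  p∉I = mk⇔ (λ ()) (λ (p∈I , _) → contradiction p∈I p∉I)
    reduct⇔⊩ (⋀ A H) = mk⇔ (λ h x → to (reduct⇔⊩ (H x)) (h x))
                           (λ h x → from (reduct⇔⊩ (H x)) (h x))
    reduct⇔⊩ (⋁ A H) = mk⇔ (λ (x , h) → x , to (reduct⇔⊩ (H x)) h)
                           (λ (x , h) → x , from (reduct⇔⊩ (H x)) h)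
    reduct⇔⊩ {J = J} {I = I} (F ⇒ G) with em {I ⊨ (F ⇒ G)}
    ... | no ¬s = mk⇔ (λ ()) (λ (h , _) → contradiction (from (⊨⇔⊩ (F ⇒ G)) (h , h)) ¬s)
    ... | yes s = mk⇔ (λ t → proj₁ (to (⊨⇔⊩ (F ⇒ G)) s) , imp t) (λ (_ , k) → back k)
      where
      imp : J ⊨ (reduct em I F ⇒ reduct em I G) → ⟨ J ∣ I ⟩⊩ F → ⟨ J ∣ I ⟩⊩ G
      imp (inj₁ ¬f) f = contradiction (from (reduct⇔⊩ F) f) ¬f
      imp (inj₂ g)  _ = to (reduct⇔⊩ G) g

      back : (⟨ J ∣ I ⟩⊩ F → ⟨ J ∣ I ⟩⊩ G) → J ⊨ (reduct em I F ⇒ reduct em I G)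
      back k with em {J ⊨ reduct em I F}
      ... | yes f = inj₂ (from (reduct⇔⊩ G) (k (to (reduct⇔⊩ F) f)))
      ... | no ¬f = inj₁ ¬f

    stable⇔equilibrium : ∀ F → IsStableModel em F I ⇔ IsEquilibrium F I
    stable⇔equilibrium F = mk⇔
      (λ (sat , min) → to   (reduct⇔⊩ F) sat , λ J → min J ∘ from (reduct⇔⊩ F))
      (λ (sat , min) → from (reduct⇔⊩ F) sat , λ J → min J ∘ to   (reduct⇔⊩ F))

mainTheorem3 : ∀ {ℓ} (em : ExcludedMiddle ℓ) (σ : Set ℓ)
    (F : Tree σ) → IsFormula F →
    (Q : Pred σ ℓ) → NoneOccurIn Q F →
    (G : Tree σ) → IsFormula G → IsDefinition Q G →
    Σ[ b ∈ Bijection (StableModels em (F ∧ G)) (StableModels em F) ]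
    (∀ I → proj₁ (Bijection.to b I) ≐ (proj₁ I ∖ Q))
mainTheorem3 em σ F _ Q free G _ (⋀ rules) = record
  { to        = λ (I , s) → I ∖ Q , fromEq F (equilibrium-∖ rules F free (toEq FG s))
  ; cong      = ∖-cong
  ; bijective =
      (λ {(I , s)} {(J , t)} e →
          equilibrium-determined rules F free (toEq FG s) (toEq FG t) e
        , equilibrium-determined rules F free (toEq FG t) (toEq FG s) (≐-sym e))
    , λ (J , s) →
          (J ∪ Derived rules J , fromEq FG (equilibrium-∪ rules F free (toEq F s)))
        -- Surjectivity concerns every stable model equal to the chosen preimage, hence `∖-cong e`;
        -- removing `Q` from the preimage returns `J` because `J` is disjoint from `Q`.
        , λ e → ≐-trans (∖-cong e) (≐-trans (∪-∖ (derived⊆Q rules))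
            (disjoint-∖ (equilibrium-disjoint F free (toEq F s))))
  } , λ _ → ≐-refl
  where
  FG = F ∧ G

  toEq : ∀ E {I} → IsStableModel em E I → IsEquilibrium E I
  toEq E = to (stable⇔equilibrium em E)

  fromEq : ∀ E {I} → IsEquilibrium E I → IsStableModel em E I
  fromEq E = from (stable⇔equilibrium em E)

  ∖-cong : ∀ {I J : Interpretation σ} → I ≐ J → I ∖ Q ≐ J ∖ Q
  ∖-cong (I⊆J , J⊆I) = (λ (p , n) → I⊆J p , n) , λ (p , n) → J⊆I p , n
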